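{- Let $\varepsilon>0$. For all real $X,D\ge1$ and every sequence of complex numbers $\{\xi_n\}_{n\sim X}$, $$\sum_{d\sim D}\Bigg|\sum_{\substack{n\sim X\\ d\mid n}}\xi_n\Bigg|^2\ll_{\varepsilon}\left(XD^{\varepsilon-1}+D\right)\sum_{n\sim X}|\xi_n|^2,$$ where the implied constant depends only on $\varepsilon$.
   Context: The notation $n\sim X$ means that $n$ ranges over the integers with $X\le n\le2X$ (similarly $d\sim D$). -}

module Defs where

open import Level using (Level; suc)
open import Algebra.Bundles using (CommutativeRing; Semiring)
import Algebra.Definitions.RawSemiring as RawSemiringDefs
open import Data.Empty using (⊥-elim)
open import Data.List.Base using (List; foldr; filter; upTo)
open import Data.List.Membership.Propositional using (_∈_)
open import Data.List.Membership.Propositional.Properties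
  using (∈-filter⁺; ∈-filter⁻; ∈-upTo⁺)
open import Data.List.Relation.Unary.Unique.Propositional using (Unique)
import Data.List.Relation.Unary.Unique.Propositional.Properties as Unique
open import Data.Nat.Base as ℕ using (ℕ; zero)
open import Data.Product.Base using (∃-syntax; _×_; _,_; proj₁; proj₂)
open import Data.Sum.Base using (inj₁; inj₂)
open import Function.Bundles using (_⇔_; mk⇔)
open import Relation.Binary.Bundles using (DecTotalOrder; Poset)
open import Relation.Binary.Core using (Rel)
open import Relation.Binary.Structures using (IsDecTotalOrder)
import Relation.Binary.Construct.NonStrictToStrict as ToStrict
open import Relation.Nullary using (¬_; Dec; yes; no)
open import Relation.Nullary.Decidable using (_×-dec_)
open import Relation.Unary using (Pred)

-- The classical real numbers, axiomatised as a complete ordered field (unique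
-- up to isomorphism).  Decidability of the order and the Archimedean property
-- follow from the other axioms in classical logic; they are listed because
-- Agda's logic is constructive.
record CompleteOrderedField (ℓ : Level) : Set (suc ℓ) where
  infix 4 _≤_
  field
    commutativeRing : CommutativeRing ℓ ℓ

  open CommutativeRing commutativeRing public
  open RawSemiringDefs (Semiring.rawSemiring semiring) public
    using (_^_) renaming (_×_ to _·_)

  ι : ℕ → Carrier
  ι n = n · 1#

  field
    _≤_             : Rel Carrier ℓ
    isDecTotalOrder : IsDecTotalOrder _≈_ _≤_

  open ToStrict _≈_ _≤_ public using (_<_)

  IsUpperBound : Pred Carrier ℓ → Carrier → Set ℓ
  IsUpperBound P b = ∀ x → P x → x ≤ b

  IsSupremum : Pred Carrier ℓ → Carrier → Set ℓ
  IsSupremum P s = IsUpperBound P s × (∀ b → IsUpperBound P b → s ≤ b)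

  field
    0≉1         : ¬ 0# ≈ 1#
    inverse     : ∀ x → ¬ x ≈ 0# → ∃[ y ] x * y ≈ 1#
    +-monoʳ-≤   : ∀ z {x y} → x ≤ y → z + x ≤ z + y
    *-pos       : ∀ {x y} → 0# < x → 0# < y → 0# < x * y
    archimedean : ∀ x → ∃[ n ] x ≤ ι n
    complete    : (P : Pred Carrier ℓ) → (∃[ x ] P x) → (∃[ b ] IsUpperBound P b) →
                  ∃[ s ] IsSupremum P s

module Reals {ℓ} (R : CompleteOrderedField ℓ) where

  open CompleteOrderedField R
  open import Algebra.Properties.Ring ring using (-‿distribˡ-*; -‿involutive)
  open import Algebra.Properties.Semiring.Exp semiring using (^-homo-*; ^-assocʳ; ^-congʳ)
  open import Algebra.Properties.Semiring.Mult semiring using (×-homo-+; ×1-homo-*)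

  decTotalOrder : DecTotalOrder ℓ ℓ ℓ
  decTotalOrder = record { isDecTotalOrder = isDecTotalOrder }

  open DecTotalOrder decTotalOrder public
    using (_≤?_; _≟_; poset; total; antisym)
    renaming (refl to ≤-refl; trans to ≤-trans; reflexive to ≤-reflexive)
  open import Relation.Binary.Reasoning.PartialOrder poset

  private
    ≰⇒> : ∀ {x y} → ¬ x ≤ y → y < x
    ≰⇒> = ToStrict.≰⇒> _≈_ _≤_ sym ≤-reflexive total

    <⇒≱ : ∀ {x y} → x < y → ¬ y ≤ x
    <⇒≱ = ToStrict.<⇒≱ _≈_ _≤_ antisym

    +-monoˡ-≤ : ∀ z {x y} → x ≤ y → x + z ≤ y + z
    +-monoˡ-≤ z {x} {y} x≤y = begin
      x + z  ≈⟨ +-comm x z ⟩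
      z + x  ≤⟨ +-monoʳ-≤ z x≤y ⟩
      z + y  ≈⟨ +-comm z y ⟩
      y + z  ∎

    *-nonNeg : ∀ {x y} → 0# ≤ x → 0# ≤ y → 0# ≤ x * y
    *-nonNeg {x} {y} 0≤x 0≤y with 0# ≟ x | 0# ≟ y
    ... | yes 0≈x | _       = ≤-reflexive (trans (sym (zeroˡ y)) (*-congʳ 0≈x))
    ... | no _    | yes 0≈y = ≤-reflexive (trans (sym (zeroʳ x)) (*-congˡ 0≈y))
    ... | no 0≉x  | no 0≉y  = proj₁ (*-pos (0≤x , 0≉x) (0≤y , 0≉y))

    x≤y⇒0≤y-x : ∀ {x y} → x ≤ y → 0# ≤ y + - x
    x≤y⇒0≤y-x {x} {y} x≤y = begin
      0#       ≈⟨ -‿inverseʳ x ⟨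
      x + - x  ≤⟨ +-monoˡ-≤ (- x) x≤y ⟩
      y + - x  ∎

    [y-x]+x≈y : ∀ x y → (y + - x) + x ≈ y
    [y-x]+x≈y x y =
      trans (+-assoc y (- x) x) (trans (+-congˡ (-‿inverseˡ x)) (+-identityʳ y))

    *-monoˡ-≤ : ∀ {z x y} → 0# ≤ z → x ≤ y → x * z ≤ y * z
    *-monoˡ-≤ {z} {x} {y} 0≤z x≤y = begin
      x * z                  ≈⟨ +-identityˡ (x * z) ⟨
      0# + x * z             ≤⟨ +-monoˡ-≤ (x * z) (*-nonNeg (x≤y⇒0≤y-x x≤y) 0≤z) ⟩
      (y + - x) * z + x * z  ≈⟨ distribʳ z (y + - x) x ⟨
      ((y + - x) + x) * z    ≈⟨ *-congʳ ([y-x]+x≈y x y) ⟩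
      y * z                  ∎

    *-monoʳ-≤ : ∀ {z x y} → 0# ≤ z → x ≤ y → z * x ≤ z * y
    *-monoʳ-≤ {z} {x} {y} 0≤z x≤y = begin
      z * x  ≈⟨ *-comm z x ⟩
      x * z  ≤⟨ *-monoˡ-≤ 0≤z x≤y ⟩
      y * z  ≈⟨ *-comm y z ⟩
      z * y  ∎

    *-monoˡ-< : ∀ {z x y} → 0# < z → x < y → x * z < y * z
    *-monoˡ-< {z} {x} {y} (0≤z , 0≉z) (x≤y , x≉y) =
      *-monoˡ-≤ 0≤z x≤y , λ xz≈yz → proj₂ 0<[y-x]z (sym (eq xz≈yz))
      where
      0≉y-x : ¬ 0# ≈ y + - x
      0≉y-x 0≈y-x = x≉y
        (trans (sym (+-identityˡ x)) (trans (+-congʳ 0≈y-x) ([y-x]+x≈y x y)))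

      0<[y-x]z : 0# < (y + - x) * z
      0<[y-x]z = *-pos (x≤y⇒0≤y-x x≤y , 0≉y-x) (0≤z , 0≉z)

      eq : x * z ≈ y * z → (y + - x) * z ≈ 0#
      eq xz≈yz = trans (distribʳ z y (- x))
        (trans (+-cong (sym xz≈yz) (sym (-‿distribˡ-* x z))) (-‿inverseʳ (x * z)))

    *-cancelʳ-≤ : ∀ {z x y} → 0# < z → x * z ≤ y * z → x ≤ y
    *-cancelʳ-≤ {z} {x} {y} 0<z xz≤yz with x ≤? y
    ... | yes x≤y = x≤y
    ... | no  x≰y = ⊥-elim (<⇒≱ (*-monoˡ-< 0<z (≰⇒> x≰y)) xz≤yz)

    0≤1 : 0# ≤ 1#
    0≤1 with total 0# 1#
    ... | inj₁ p = p
    ... | inj₂ 1≤0 = begin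
      0#           ≤⟨ *-nonNeg 0≤-1 0≤-1 ⟩
      - 1# * - 1#  ≈⟨ -‿distribˡ-* 1# (- 1#) ⟨
      - (1# * - 1#) ≈⟨ -‿cong (*-identityˡ (- 1#)) ⟩
      - - 1#       ≈⟨ -‿involutive 1# ⟩
      1#           ∎
      where
      0≤-1 : 0# ≤ - 1#
      0≤-1 = begin
        0#         ≤⟨ x≤y⇒0≤y-x 1≤0 ⟩
        0# + - 1#  ≈⟨ +-identityˡ (- 1#) ⟩
        - 1#       ∎

    0<1 : 0# < 1#
    0<1 = 0≤1 , 0≉1

    ι-nonNeg : ∀ n → 0# ≤ ι n
    ι-nonNeg zero      = ≤-refl
    ι-nonNeg (ℕ.suc n) = begin
      0#        ≈⟨ +-identityʳ 0# ⟨
      0# + 0#   ≤⟨ +-monoˡ-≤ 0# 0≤1 ⟩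
      1# + 0#   ≤⟨ +-monoʳ-≤ 1# (ι-nonNeg n) ⟩
      1# + ι n  ∎

    +-cancelˡ-≤ : ∀ z {x y} → z + x ≤ z + y → x ≤ y
    +-cancelˡ-≤ z {x} {y} p = begin
      x              ≈⟨ lem x ⟨
      - z + (z + x)  ≤⟨ +-monoʳ-≤ (- z) p ⟩
      - z + (z + y)  ≈⟨ lem y ⟩
      y              ∎
      where
      lem : ∀ w → - z + (z + w) ≈ w
      lem w = trans (sym (+-assoc (- z) z w))
                    (trans (+-congʳ (-‿inverseˡ z)) (+-identityˡ w))

    ι-cancel-≤ : ∀ m n → ι m ≤ ι n → m ℕ.≤ n
    ι-cancel-≤ zero      n         _ = ℕ.z≤n
    ι-cancel-≤ (ℕ.suc m) (ℕ.suc n) p = ℕ.s≤s (ι-cancel-≤ m n (+-cancelˡ-≤ 1# p))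
    ι-cancel-≤ (ℕ.suc m) zero      p = ⊥-elim (<⇒≱ 0<1 (begin
      1#        ≈⟨ +-identityʳ 1# ⟨
      1# + 0#   ≤⟨ +-monoʳ-≤ 1# (ι-nonNeg m) ⟩
      1# + ι m  ≤⟨ p ⟩
      0#        ∎))

    ^-pos : ∀ {x} n → 0# < x → 0# < x ^ n
    ^-pos zero      _   = 0<1
    ^-pos (ℕ.suc n) 0<x = *-pos 0<x (^-pos n 0<x)

    ^-monoˡ-≤ : ∀ n {x y} → 0# < x → x ≤ y → 0# < y → x ^ n ≤ y ^ n
    ^-monoˡ-≤ zero      _   _   _   = ≤-refl
    ^-monoˡ-≤ (ℕ.suc n) 0<x x≤y 0<y =
      ≤-trans (*-monoˡ-≤ (proj₁ (^-pos n 0<x)) x≤y)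
              (*-monoʳ-≤ (proj₁ 0<y) (^-monoˡ-≤ n 0<x x≤y 0<y))

    ^-cancel-≤ : ∀ k {x y} → 0# < y → x ^ ℕ.suc k ≤ y ^ ℕ.suc k → x ≤ y
    ^-cancel-≤ k {x} {y} 0<y p with x ≤? y
    ... | yes x≤y = x≤y
    ... | no  x≰y = ⊥-elim (<⇒≱ (*-monoˡ-< (^-pos k 0<x) y<x) (begin
      x * x ^ k  ≤⟨ p ⟩
      y * y ^ k  ≤⟨ *-monoʳ-≤ (proj₁ 0<y) (^-monoˡ-≤ k 0<y (proj₁ y<x) 0<x) ⟩
      y * x ^ k  ∎))
      where
      y<x : y < x
      y<x = ≰⇒> x≰y

      0<x : 0# < x
      0<x = ≰⇒> λ x≤0 → x≰y (≤-trans x≤0 (proj₁ 0<y))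

    1≤x⇒0<x : ∀ {x} → 1# ≤ x → 0# < x
    1≤x⇒0<x 1≤x = ≰⇒> λ x≤0 → <⇒≱ 0<1 (≤-trans 1≤x x≤0)

    ^-monoʳ-≤ : ∀ {a m n} → 1# ≤ a → m ℕ.≤ n → a ^ m ≤ a ^ n
    ^-monoʳ-≤ {a} {_} {zero}    1≤a ℕ.z≤n = ≤-refl
    ^-monoʳ-≤ {a} {_} {ℕ.suc n} 1≤a ℕ.z≤n = begin
      1#          ≤⟨ ^-monoʳ-≤ {a} {0} {n} 1≤a ℕ.z≤n ⟩
      a ^ n       ≈⟨ *-identityˡ (a ^ n) ⟨
      1# * a ^ n  ≤⟨ *-monoˡ-≤ (proj₁ (^-pos n (1≤x⇒0<x 1≤a))) 1≤a ⟩
      a * a ^ n   ∎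
    ^-monoʳ-≤ {a} 1≤a (ℕ.s≤s m≤n) =
      *-monoʳ-≤ (proj₁ (1≤x⇒0<x 1≤a)) (^-monoʳ-≤ 1≤a m≤n)

  -- With r = (n - m) / (k + 1), every rational number, the three conditions say
  -- 0 ≤ y, r ≤ t and y ≤ aʳ, cleared of denominators and of negative exponents.
  BelowRationalPower : Carrier → Carrier → Pred Carrier ℓ
  BelowRationalPower a t y = ∃[ m ] ∃[ n ] ∃[ k ]
    0# ≤ y × ι n ≤ ι m + ι (ℕ.suc k) * t × y ^ ℕ.suc k * a ^ m ≤ a ^ n

  private
    inhabited : ∀ {a} → 1# ≤ a → ∀ t → ∃[ y ] BelowRationalPower a t y
    inhabited {a} 1≤a t with m , -t≤m ← archimedean (- t) =
      0# , m , 0 , 0 , ≤-refl , 0≤m+t , (begin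
        0# * 1# * a ^ m  ≈⟨ *-congʳ (zeroˡ 1#) ⟩
        0# * a ^ m       ≈⟨ zeroˡ (a ^ m) ⟩
        0#               ≤⟨ 0≤1 ⟩
        1#               ∎)
      where
      0≤m+t : 0# ≤ ι m + ι 1 * t
      0≤m+t = begin
        0#             ≈⟨ -‿inverseˡ t ⟨
        - t + t        ≤⟨ +-monoˡ-≤ t -t≤m ⟩
        ι m + t        ≈⟨ +-congˡ (*-identityˡ t) ⟨
        ι m + 1# * t   ≈⟨ +-congˡ (*-congʳ (+-identityʳ 1#)) ⟨
        ι m + ι 1 * t  ∎

    bounded : ∀ {a} → 1# ≤ a → ∀ t → ∃[ b ] IsUpperBound (BelowRationalPower a t) b
    bounded {a} 1≤a t with N , t≤N ← archimedean t = a ^ N , bound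
      where
      0<a : 0# < a
      0<a = 1≤x⇒0<x 1≤a

      bound : IsUpperBound (BelowRationalPower a t) (a ^ N)
      bound y (m , n , k , 0≤y , n≤m+qt , yqam≤an) =
        ^-cancel-≤ k (^-pos N 0<a) (*-cancelʳ-≤ (^-pos m 0<a) (begin
          y ^ q * a ^ m           ≤⟨ yqam≤an ⟩
          a ^ n                   ≤⟨ ^-monoʳ-≤ 1≤a n≤qN+m ⟩
          a ^ (N ℕ.* q ℕ.+ m)     ≈⟨ ^-homo-* a (N ℕ.* q) m ⟩
          a ^ (N ℕ.* q) * a ^ m   ≈⟨ *-congʳ (^-assocʳ a N q) ⟨
          (a ^ N) ^ q * a ^ m     ∎))
        where
        q : ℕ
        q = ℕ.suc k

        n≤qN+m : n ℕ.≤ N ℕ.* q ℕ.+ m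
        n≤qN+m = ι-cancel-≤ n (N ℕ.* q ℕ.+ m) (begin
          ι n                  ≤⟨ n≤m+qt ⟩
          ι m + ι q * t        ≤⟨ +-monoʳ-≤ (ι m) (*-monoʳ-≤ (ι-nonNeg q) t≤N) ⟩
          ι m + ι q * ι N      ≈⟨ +-comm (ι m) (ι q * ι N) ⟩
          ι q * ι N + ι m      ≈⟨ +-congʳ (*-comm (ι q) (ι N)) ⟩
          ι N * ι q + ι m      ≈⟨ +-congʳ (×1-homo-* N q) ⟨
          ι (N ℕ.* q) + ι m    ≈⟨ ×-homo-+ 1# (N ℕ.* q) m ⟨
          ι (N ℕ.* q ℕ.+ m)    ∎)

    power : ∀ a → 1# ≤ a → ∀ t → ∃[ s ] IsSupremum (BelowRationalPower a t) s
    power a 1≤a t = complete _ (inhabited 1≤a t) (bounded 1≤a t)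

  -- aᵗ = sup { aʳ : r rational, r ≤ t } for a ≥ 1.
  _^ᴿ[_]_ : ∀ a → 1# ≤ a → Carrier → Carrier
  a ^ᴿ[ 1≤a ] t = proj₁ (power a 1≤a t)

  ^ᴿ-isSupremum : ∀ a (1≤a : 1# ≤ a) t → IsSupremum (BelowRationalPower a t) (a ^ᴿ[ 1≤a ] t)
  ^ᴿ-isSupremum a 1≤a t = proj₂ (power a 1≤a t)

  infixl 6 _+ℂ_
  record ℂ : Set ℓ where
    constructor _+i_
    field
      re im : Carrier

  open ℂ public

  0ℂ : ℂ
  0ℂ = 0# +i 0#

  _+ℂ_ : ℂ → ℂ → ℂ
  z +ℂ w = (re z + re w) +i (im z + im w)

  ∣_∣² : ℂ → Carrier
  ∣ z ∣² = re z ^ 2 + im z ^ 2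

  -- For X > 0 an integer n with X ≤ n ≤ 2X is a natural number.
  infix 4 _∼_ _∼?_
  _∼_ : ℕ → Carrier → Set ℓ
  n ∼ X = X ≤ ι n × ι n ≤ ι 2 * X

  _∼?_ : ∀ n X → Dec (n ∼ X)
  n ∼? X = (X ≤? ι n) ×-dec (ι n ≤? ι 2 * X)

  dyadic : Carrier → List ℕ
  dyadic X = filter (_∼? X) (upTo (ℕ.suc (proj₁ (archimedean (ι 2 * X)))))

  ∈-dyadic : ∀ n X → n ∈ dyadic X ⇔ n ∼ X
  ∈-dyadic n X = mk⇔
    (λ n∈ → proj₂ (∈-filter⁻ (_∼? X) {xs = upTo _} n∈))
    (λ n∼X → ∈-filter⁺ (_∼? X)
      (∈-upTo⁺ (ℕ.s≤s (ι-cancel-≤ n _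
        (≤-trans (proj₂ n∼X) (proj₂ (archimedean (ι 2 * X)))))))
      n∼X)

  dyadic-unique : ∀ X → Unique (dyadic X)
  dyadic-unique X = Unique.filter⁺ (_∼? X) (Unique.upTo⁺ _)

  ∑ : List ℕ → (ℕ → Carrier) → Carrier
  ∑ ns f = foldr (λ n s → f n + s) 0# ns

  ∑ℂ : List ℕ → (ℕ → ℂ) → ℂ
  ∑ℂ ns f = foldr (λ n s → f n +ℂ s) 0ℂ ns

{-# OPTIONS --safe #-}
module Submission where

-- By duality it suffices to bound, for each d ∼ D, the sum over d′ ∼ D of the number of n ∼ X
-- divisible by both d and d′.  That number is at most 1 + X / lcm(d, d′) ≤ 1 + X gcd(d, d′) / D²,
-- and the sum of gcd(d, d′) over d′ ∼ D is at most 3 D τ(d).  The divisor bound τ(d)^q ≪ d with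
-- 1/q ≤ ε then turns the resulting X τ(d) / D + D into X D^(ε-1) + D.

-- Row sums suffice because the matrix indexed by d and d′ is symmetric with non-negative entries,
-- so its norm is at most its largest row sum. The summand 1 is the rounding error in counting
-- multiples within an interval; summed over the at most 2D values of d′ it is the source of the
-- term D. The gcd sum is linear in D because gcd(d, d′) is at most the sum of the common divisors
-- g, and the weight g cancels the density 1/g of the multiples of g. The power D^(ε-1) is given as
-- a supremum over rational exponents, so it is bounded below by exhibiting a member of the defining
-- set, and membership is an inequality between integral powers. This is why the divisor bound keeps
-- the root-free form τ(d)^q ≤ C d, proved within the natural numbers. Its constant (q^q)^(2^q)
-- depends on q alone, hence on ε alone.

open import Defs
open import Level using (Level)
import Algebra.Properties.CommutativeSemigroup as CommutativeSemigroupProperties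
import Algebra.Properties.CommutativeSemiring.Exp as Exp
import Algebra.Properties.Ring as RingProperties
import Algebra.Properties.Semiring.Mult as Mult
import Algebra.Solver.Ring.NaturalCoefficients.Default as SemiringSolver
open import Data.Empty using (⊥-elim)
open import Data.List.Base as List using (List; []; _∷_; [_]; _++_; length; filter)
open import Data.List.Membership.Propositional using (_∈_)
open import Data.List.Membership.Propositional.Properties
  using (∈-++⁺ˡ; ∈-++⁺ʳ; ∈-map⁺; ∈-filter⁺; ∈-filter⁻)
open import Data.List.Properties using (length-++; length-map; length-filter)
open import Data.List.Relation.Unary.All as All using (All; []; _∷_)
import Data.List.Relation.Unary.All.Properties as All
open import Data.List.Relation.Unary.AllPairs using (AllPairs; []; _∷_)
import Data.List.Relation.Unary.AllPairs.Properties as AllPairs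
open import Data.List.Relation.Unary.Any using (here; there)
open import Data.Nat.Base as ℕ using (ℕ; zero; suc; NonZero)
open import Data.Nat.Coprimality using (Coprime; coprime-divisor)
open import Data.Nat.Divisibility
open import Data.Nat.DivMod using (_/_; _%_; m≡m%n+[m/n]*n; m%n<n)
open import Data.Nat.GCD using (gcd; gcd[m,n]∣m; gcd[m,n]∣n)
open import Data.Nat.LCM using (lcm; lcm-least; gcd*lcm)
open import Data.Nat.ListAction using (product)
open import Data.Nat.Primality
  using (Prime; prime?; prime⇒irreducible; prime⇒nonZero; prime⇒nonTrivial)
open import Data.Nat.Primality.Factorisation using (factorise; module PrimeFactorisation)

open import Data.Product.Base using (∃-syntax; _×_; _,_; proj₁; proj₂)
open import Data.Sum.Base using (inj₁; inj₂)
open import Function.Bundles using (module Equivalence)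
open import Relation.Binary.PropositionalEquality as ≡ using (_≡_; _≢_)
open import Relation.Nullary using (¬_; Dec; yes; no)

-- The divisor bound over the natural numbers.

module DivisorBounds where

  open import Data.Nat.Base using (_+_; _*_; _^_; _≤_; z≤n; s≤s; nonTrivial⇒n>1)
  open import Data.Nat.Properties
  open ≡ using (refl; sym; trans; cong; subst)
  open CommutativeSemigroupProperties *-commutativeSemigroup
    using (x∙yz≈y∙xz) renaming (interchange to *-interchange)

  -- L may contain repetitions and non-divisors: its length is only an upper bound for τ(n).
  DivisorsIn : ℕ → List ℕ → Set
  DivisorsIn n L = ∀ {g} → g ∣ n → g ∈ L

  -- The products p^i g with i ≤ a and g in `L`, arranged so that the recursion peels off one factor
  -- p.
  powerMultiples : ℕ → ℕ → List ℕ → List ℕ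
  powerMultiples p zero    L = L
  powerMultiples p (suc a) L = L ++ List.map (p *_) (powerMultiples p a L)

  length-powerMultiples : ∀ p a L → length (powerMultiples p a L) ≡ suc a * length L
  length-powerMultiples p zero    L = sym (+-identityʳ (length L))
  length-powerMultiples p (suc a) L = trans (length-++ L)
    (cong (length L +_)
      (trans (length-map (p *_) (powerMultiples p a L)) (length-powerMultiples p a L)))

  prime∤⇒coprime : ∀ {p g} → Prime p → ¬ p ∣ g → Coprime g p
  prime∤⇒coprime pr p∤g (d∣g , d∣p) with prime⇒irreducible pr d∣p
  ... | inj₁ d≡1  = d≡1
  ... | inj₂ refl = ⊥-elim (p∤g d∣g)

  coprime-divisor-^ : ∀ {g p m} a → Coprime g p → g ∣ p ^ a * m → g ∣ m
  coprime-divisor-^ {g} {p} {m} zero    c g∣ = subst (g ∣_) (*-identityˡ m) g∣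
  coprime-divisor-^ {g} {p} {m} (suc a) c g∣ =
    coprime-divisor-^ a c (coprime-divisor c (subst (g ∣_) (*-assoc p (p ^ a) m) g∣))

  -- A divisor g prime to p already divides m and lies in the first copy of `L`; otherwise g = k p,
  -- and cancelling p leaves a divisor k for the smaller exponent.
  divisorsIn-powerMultiples : ∀ {p m L} a → Prime p → DivisorsIn m L →
                              DivisorsIn (p ^ a * m) (powerMultiples p a L)
  divisorsIn-powerMultiples {m = m} zero    pr L∋ g∣ = L∋ (subst (_ ∣_) (*-identityˡ m) g∣)
  divisorsIn-powerMultiples {p} {m} {L} (suc a) pr L∋ {g} g∣ with p ∣? g
  ... | no p∤g = ∈-++⁺ˡ (L∋ (coprime-divisor-^ (suc a) (prime∤⇒coprime pr p∤g) g∣))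
  ... | yes (divides k refl) =
    ∈-++⁺ʳ L (subst (_∈ List.map (p *_) (powerMultiples p a L)) (*-comm p k)
      (∈-map⁺ (p *_) (divisorsIn-powerMultiples a pr L∋ k∣)))
    where
    instance _ = prime⇒nonZero pr
    k∣ : k ∣ p ^ a * m
    k∣ = *-cancelˡ-∣ p (subst (_∣ p * (p ^ a * m)) (*-comm k p)
           (subst (k * p ∣_) (*-assoc p (p ^ a) m) g∣))

  [m*n]^k≡m^k*n^k : ∀ m n k → (m * n) ^ k ≡ m ^ k * n ^ k
  [m*n]^k≡m^k*n^k m n zero    = refl
  [m*n]^k≡m^k*n^k m n (suc k) = trans (cong (m * n *_) ([m*n]^k≡m^k*n^k m n k))
    (*-interchange m n (m ^ k) (n ^ k))

  -- The bound τ(n) ≤ (C n)^(1/q), raised to the q-th power.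
  DivisorBound : ℕ → ℕ → ℕ → Set
  DivisorBound q C n = ∃[ L ] DivisorsIn n L × length L ^ q ≤ C * n

  -- Adjoining p^a multiplies the length of the list by a + 1, so a local bound for (a + 1)^q
  -- multiplies the constants.
  divisorBound-* : ∀ {p q B C m} a → Prime p → suc a ^ q ≤ B * p ^ a →
                   DivisorBound q C m → DivisorBound q (B * C) (p ^ a * m)
  divisorBound-* {p} {q} {B} {C} {m} a pr small (L , L∋ , |L|^q≤) =
    powerMultiples p a L , divisorsIn-powerMultiples a pr L∋ , (begin
      length (powerMultiples p a L) ^ q  ≡⟨ cong (_^ q) (length-powerMultiples p a L) ⟩
      (suc a * length L) ^ q             ≡⟨ [m*n]^k≡m^k*n^k (suc a) (length L) q ⟩
      suc a ^ q * length L ^ q           ≤⟨ *-mono-≤ small |L|^q≤ ⟩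
      (B * p ^ a) * (C * m)              ≡⟨ *-interchange B (p ^ a) C m ⟩
      (B * C) * (p ^ a * m)              ∎)
    where open ≤-Reasoning

  1+n≤2^n : ∀ n → suc n ≤ 2 ^ n
  1+n≤2^n zero    = ≤-refl
  1+n≤2^n (suc n) = begin
    suc (suc n)     ≤⟨ s≤s (1+n≤2^n n) ⟩
    1 + 2 ^ n       ≤⟨ +-mono-≤ (m^n>0 2 n) (m≤m+n (2 ^ n) 0) ⟩
    2 * 2 ^ n       ∎
    where open ≤-Reasoning

  -- Writing a = r + k q with r < q, 1 + a ≤ q (1 + k) ≤ q 2ᵏ.
  [1+a]^q≤q^q*2^a : ∀ a q .{{_ : NonZero q}} → suc a ^ q ≤ q ^ q * 2 ^ a
  [1+a]^q≤q^q*2^a a q = begin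
    suc a ^ q              ≤⟨ ^-monoˡ-≤ q 1+a≤ ⟩
    (q * 2 ^ k) ^ q        ≡⟨ [m*n]^k≡m^k*n^k q (2 ^ k) q ⟩
    q ^ q * (2 ^ k) ^ q    ≡⟨ cong (q ^ q *_) (^-*-assoc 2 k q) ⟩
    q ^ q * 2 ^ (k * q)    ≤⟨ *-monoʳ-≤ (q ^ q) (^-monoʳ-≤ 2 kq≤a) ⟩
    q ^ q * 2 ^ a          ∎
    where
    open ≤-Reasoning
    k = a / q
    kq≤a : k * q ≤ a
    kq≤a = ≤-trans (m≤n+m (k * q) (a % q)) (≤-reflexive (sym (m≡m%n+[m/n]*n a q)))
    1+a≤ : suc a ≤ q * 2 ^ k
    1+a≤ = begin
      suc a                  ≡⟨ cong suc (m≡m%n+[m/n]*n a q) ⟩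
      suc (a % q) + k * q    ≤⟨ +-monoˡ-≤ (k * q) (m%n<n a q) ⟩
      suc k * q              ≤⟨ *-monoˡ-≤ q (1+n≤2^n k) ⟩
      2 ^ k * q              ≡⟨ *-comm (2 ^ k) q ⟩
      q * 2 ^ k              ∎

  -- The predicate `P` travels along so that primality and lower bounds survive the removal of every
  -- copy of j.
  extractPower : ∀ {P : ℕ → Set} j ns → All P ns →
    ∃[ a ] ∃[ ms ] All P ms × All (_≢ j) ms × product ns ≡ j ^ a * product ms
  extractPower j []       []        = 0 , [] , [] , [] , refl
  extractPower j (n ∷ ns) (pn ∷ ps) with extractPower j ns ps | n ≟ j
  ... | a , ms , pms , ≢j , eq | yes refl =
    suc a , ms , pms , ≢j , trans (cong (j *_) eq) (sym (*-assoc j (j ^ a) (product ms)))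
  ... | a , ms , pms , ≢j , eq | no n≢j =
    a , n ∷ ms , pn ∷ pms , n≢j ∷ ≢j , trans (cong (n *_) eq) (x∙yz≈y∙xz n (j ^ a) (product ms))

  -- Prime factors are adjoined one at a time with exponent 1, repeated ones included: each doubles
  -- the list, and 2^q ≤ p pays for it. The constant therefore stays 1 whatever the multiplicities.
  divisorBound-largePrimes : ∀ q ps → All Prime ps → All (2 ^ q ≤_) ps →
                             DivisorBound q 1 (product ps)
  divisorBound-largePrimes q []       []          []            =
    [ 1 ] , (λ g∣1 → here (∣1⇒≡1 g∣1)) , ≤-reflexive (^-zeroˡ q)
  divisorBound-largePrimes q (p ∷ ps) (pr ∷ prs) (2^q≤p ∷ 2^q≤) =
    subst (DivisorBound q 1) (cong (_* product ps) (^-identityʳ p))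
      (divisorBound-* {q = q} {B = 1} {C = 1} 1 pr 2^q≤1*p^1
        (divisorBound-largePrimes q ps prs 2^q≤))
    where
    2^q≤1*p^1 : 2 ^ q ≤ 1 * p ^ 1
    2^q≤1*p^1 = ≤-trans 2^q≤p (≤-reflexive (sym (trans (*-identityˡ (p ^ 1)) (^-identityʳ p))))

  -- Each integer j < 2^q contributes at most a factor q^q to the constant, while a prime p ≥ 2^q
  -- contributes none since it multiplies τ(n)^q by at most 2^q ≤ p.
  divisorBound-primesFrom : ∀ q .{{_ : NonZero q}} k j → j + k ≡ 2 ^ q →
    ∀ ps → All Prime ps → All (j ≤_) ps → DivisorBound q ((q ^ q) ^ k) (product ps)
  divisorBound-primesFrom q zero    j j+0≡2^q ps prs j≤ =
    divisorBound-largePrimes q ps prs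
      (subst (λ n → All (n ≤_) ps) (trans (sym (+-identityʳ j)) j+0≡2^q) j≤)
  divisorBound-primesFrom q (suc k) j j+1+k≡2^q ps prs j≤ with prime? j
  ... | no ¬pr = weaken (divisorBound-primesFrom q k (suc j) 1+j+k≡2^q ps prs
          (All.zipWith (λ { (pr , j≤p) → ≤∧≢⇒< j≤p λ { refl → ¬pr pr } }) (prs , j≤)))
    where
    1+j+k≡2^q : suc j + k ≡ 2 ^ q
    1+j+k≡2^q = trans (sym (+-suc j k)) j+1+k≡2^q
    -- A non-prime j is charged a factor q^q as well, so that the constant depends on k alone.
    weaken : DivisorBound q ((q ^ q) ^ k) (product ps) →
             DivisorBound q ((q ^ q) ^ suc k) (product ps)
    weaken (L , L∋ , |L|^q≤) = L , L∋ , ≤-trans |L|^q≤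
      (*-monoˡ-≤ (product ps) (m≤n*m ((q ^ q) ^ k) (q ^ q) {{m^n≢0 q q}}))
  -- A small prime must be removed with its full exponent a, because the loss q^q is affordable only
  -- once: (a + 1)^q ≤ q^q 2^a ≤ q^q j^a.
  ... | yes pr with extractPower j ps (All.zipWith (λ x → x) (prs , j≤))
  ...   | a , ms , prs×j≤ , ≢j , eq = subst (DivisorBound q ((q ^ q) ^ suc k)) (sym eq)
    (divisorBound-* {q = q} {B = q ^ q} a pr
      (≤-trans ([1+a]^q≤q^q*2^a a q) (*-monoʳ-≤ (q ^ q) (^-monoˡ-≤ a 2≤j)))
      (divisorBound-primesFrom q k (suc j) (trans (sym (+-suc j k)) j+1+k≡2^q) ms
        (All.map proj₁ prs×j≤)
        (All.zipWith (λ ((_ , j≤m) , m≢j) → ≤∧≢⇒< j≤m (λ j≡m → m≢j (sym j≡m))) (prs×j≤ , ≢j))))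
    where
    2≤j : 2 ≤ j
    2≤j = nonTrivial⇒n>1 j {{prime⇒nonTrivial pr}}

  divisorBound : ∀ q .{{_ : NonZero q}} → ∃[ C ] ∀ n .{{_ : NonZero n}} → DivisorBound q C n
  divisorBound q = (q ^ q) ^ (2 ^ q) , λ n →
    let open PrimeFactorisation (factorise n) in
    subst (DivisorBound q ((q ^ q) ^ (2 ^ q))) (sym isFactorisation)
      (divisorBound-primesFrom q (2 ^ q) 0 refl factors factorsPrime
        (All.universal (λ _ → z≤n) factors))

-- Arithmetic in the ordered field.

module OrderedFieldProperties {ℓ} (R : CompleteOrderedField ℓ) where

  open CompleteOrderedField R
  open Reals R
  open RingProperties ring using (-‿distribˡ-*; -‿distribʳ-*; -‿involutive)
  open Mult semiring using (×-homo-+; ×1-homo-*)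
  open SemiringSolver commutativeSemiring using (solve; _:=_; _:+_; _:*_)
  open import Relation.Binary.Reasoning.PartialOrder poset

  +-mono-≤ : ∀ {w x y z} → w ≤ x → y ≤ z → w + y ≤ x + z
  +-mono-≤ {w} {x} {y} {z} w≤x y≤z = begin
    w + y  ≤⟨ +-monoʳ-≤ w y≤z ⟩
    w + z  ≈⟨ +-comm w z ⟩
    z + w  ≤⟨ +-monoʳ-≤ z w≤x ⟩
    z + x  ≈⟨ +-comm z x ⟩
    x + z  ∎

  x+[y-x]≈y : ∀ x y → x + (y - x) ≈ y
  x+[y-x]≈y x y = begin-equality
    x + (y - x)    ≈⟨ +-congˡ (+-comm y (- x)) ⟩
    x + (- x + y)  ≈⟨ +-assoc x (- x) y ⟨
    (x - x) + y    ≈⟨ +-congʳ (-‿inverseʳ x) ⟩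
    0# + y         ≈⟨ +-identityˡ y ⟩
    y              ∎

  +-cancelʳ-≤ : ∀ z {x y} → x + z ≤ y + z → x ≤ y
  +-cancelʳ-≤ z {x} {y} x+z≤y+z = begin
    x            ≈⟨ cancel x ⟨
    x + z - z    ≤⟨ +-mono-≤ x+z≤y+z ≤-refl ⟩
    y + z - z    ≈⟨ cancel y ⟩
    y            ∎
    where
    cancel : ∀ w → w + z - z ≈ w
    cancel w = trans (+-assoc w z (- z)) (trans (+-congˡ (-‿inverseʳ z)) (+-identityʳ w))

  x≤y⇒0≤y-x : ∀ {x y} → x ≤ y → 0# ≤ y - x
  x≤y⇒0≤y-x {x} {y} x≤y = begin
    0#     ≈⟨ -‿inverseʳ x ⟨
    x - x  ≤⟨ +-mono-≤ x≤y ≤-refl ⟩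
    y - x  ∎

  +-nonNeg : ∀ {x y} → 0# ≤ x → 0# ≤ y → 0# ≤ x + y
  +-nonNeg 0≤x 0≤y = ≤-trans (≤-reflexive (sym (+-identityʳ 0#))) (+-mono-≤ 0≤x 0≤y)

  x≤x+y : ∀ {x y} → 0# ≤ y → x ≤ x + y
  x≤x+y {x} 0≤y = ≤-trans (≤-reflexive (sym (+-identityʳ x))) (+-monoʳ-≤ x 0≤y)

  x≤y+x : ∀ {x y} → 0# ≤ y → x ≤ y + x
  x≤y+x {x} {y} 0≤y = ≤-trans (x≤x+y 0≤y) (≤-reflexive (+-comm x y))

  *-nonNeg : ∀ {x y} → 0# ≤ x → 0# ≤ y → 0# ≤ x * y
  *-nonNeg {x} {y} 0≤x 0≤y with 0# ≟ x | 0# ≟ y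
  ... | yes 0≈x | _       = ≤-reflexive (trans (sym (zeroˡ y)) (*-congʳ 0≈x))
  ... | no _    | yes 0≈y = ≤-reflexive (trans (sym (zeroʳ x)) (*-congˡ 0≈y))
  ... | no 0≉x  | no 0≉y  = proj₁ (*-pos (0≤x , 0≉x) (0≤y , 0≉y))

  *-monoʳ-≤ : ∀ {z x y} → 0# ≤ z → x ≤ y → z * x ≤ z * y
  *-monoʳ-≤ {z} {x} {y} 0≤z x≤y = begin
    z * x                ≤⟨ x≤x+y (*-nonNeg 0≤z (x≤y⇒0≤y-x x≤y)) ⟩
    z * x + z * (y - x)  ≈⟨ distribˡ z x (y - x) ⟨
    z * (x + (y - x))    ≈⟨ *-congˡ (x+[y-x]≈y x y) ⟩
    z * y                ∎

  *-monoˡ-≤ : ∀ {z x y} → 0# ≤ z → x ≤ y → x * z ≤ y * z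
  *-monoˡ-≤ {z} {x} {y} 0≤z x≤y = begin
    x * z  ≈⟨ *-comm x z ⟩
    z * x  ≤⟨ *-monoʳ-≤ 0≤z x≤y ⟩
    z * y  ≈⟨ *-comm z y ⟩
    y * z  ∎

  *-mono-≤ : ∀ {w x y z} → 0# ≤ x → 0# ≤ y → w ≤ x → y ≤ z → w * y ≤ x * z
  *-mono-≤ 0≤x 0≤y w≤x y≤z = ≤-trans (*-monoˡ-≤ 0≤y w≤x) (*-monoʳ-≤ 0≤x y≤z)

  0≤x*x : ∀ x → 0# ≤ x * x
  0≤x*x x with total 0# x
  ... | inj₁ 0≤x = *-nonNeg 0≤x 0≤x
  ... | inj₂ x≤0 = begin
    0#           ≤⟨ *-nonNeg 0≤-x 0≤-x ⟩
    - x * - x    ≈⟨ -‿distribˡ-* x (- x) ⟨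
    - (x * - x)  ≈⟨ -‿cong (-‿distribʳ-* x x) ⟨
    - - (x * x)  ≈⟨ -‿involutive (x * x) ⟩
    x * x        ∎
    where
    0≤-x : 0# ≤ - x
    0≤-x = ≤-trans (x≤y⇒0≤y-x x≤0) (≤-reflexive (+-identityˡ (- x)))

  -- The defect is the square of e = y - x. Writing y as x + e removes the subtraction, so that the
  -- semiring solver applies.
  2xy≤x²+y² : ∀ x y → x * y + x * y ≤ x * x + y * y
  2xy≤x²+y² x y = begin
    x * y + x * y                  ≈⟨ +-cong x*y≈ x*y≈ ⟩
    x * (x + e) + x * (x + e)      ≤⟨ x≤x+y (0≤x*x e) ⟩
    x * (x + e) + x * (x + e) + e * e
      ≈⟨ solve 2 (λ x e → x :* (x :+ e) :+ x :* (x :+ e) :+ e :* e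
                       := x :* x :+ (x :+ e) :* (x :+ e)) refl x e ⟩
    x * x + (x + e) * (x + e)      ≈⟨ +-congˡ (*-cong (x+[y-x]≈y x y) (x+[y-x]≈y x y)) ⟩
    x * x + y * y                  ∎
    where
    e = y - x
    x*y≈ : x * y ≈ x * (x + e)
    x*y≈ = *-congˡ (sym (x+[y-x]≈y x y))

  0≤1 : 0# ≤ 1#
  0≤1 = ≤-trans (0≤x*x 1#) (≤-reflexive (*-identityˡ 1#))

  1≤x⇒0<x : ∀ {x} → 1# ≤ x → 0# < x
  1≤x⇒0<x 1≤x = ≤-trans 0≤1 1≤x , λ 0≈x →
    0≉1 (antisym 0≤1 (≤-trans 1≤x (≤-reflexive (sym 0≈x))))

  -- The inverse y equals x y², a product of non-negative factors.
  nonNegInverse : ∀ {x} → 0# < x → ∃[ y ] 0# ≤ y × x * y ≈ 1#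
  nonNegInverse {x} (0≤x , 0≉x) with inverse x (λ x≈0 → 0≉x (sym x≈0))
  ... | y , xy≈1 = y , 0≤y , xy≈1
    where
    0≤y : 0# ≤ y
    0≤y = begin
      0#           ≤⟨ *-nonNeg 0≤x (0≤x*x y) ⟩
      x * (y * y)  ≈⟨ *-assoc x y y ⟨
      x * y * y    ≈⟨ *-congʳ xy≈1 ⟩
      1# * y       ≈⟨ *-identityˡ y ⟩
      y            ∎

  *-cancelˡ-≤ : ∀ {z x y} → 0# < z → z * x ≤ z * y → x ≤ y
  *-cancelˡ-≤ {z} {x} {y} 0<z zx≤zy with nonNegInverse 0<z
  ... | v , 0≤v , zv≈1 = begin
    x            ≈⟨ cancel x ⟨
    v * (z * x)  ≤⟨ *-monoʳ-≤ 0≤v zx≤zy ⟩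
    v * (z * y)  ≈⟨ cancel y ⟩
    y            ∎
    where
    cancel : ∀ w → v * (z * w) ≈ w
    cancel w = trans (sym (*-assoc v z w))
      (trans (*-congʳ (trans (*-comm v z) zv≈1)) (*-identityˡ w))

  inverse-antitone : ∀ {x y u v} → 0# ≤ u → 0# ≤ v → x * u ≈ 1# → y * v ≈ 1# → x ≤ y → v ≤ u
  inverse-antitone {x} {y} {u} {v} 0≤u 0≤v xu≈1 yv≈1 x≤y = begin
    v            ≈⟨ *-identityʳ v ⟨
    v * 1#       ≈⟨ *-congˡ xu≈1 ⟨
    v * (x * u)  ≤⟨ *-monoʳ-≤ 0≤v (*-monoˡ-≤ 0≤u x≤y) ⟩
    v * (y * u)  ≈⟨ solve 3 (λ v y u → v :* (y :* u) := (y :* v) :* u) refl v y u ⟩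
    (y * v) * u  ≈⟨ *-congʳ yv≈1 ⟩
    1# * u       ≈⟨ *-identityˡ u ⟩
    u            ∎

  ι-homo-+ : ∀ m n → ι (m ℕ.+ n) ≈ ι m + ι n
  ι-homo-+ = ×-homo-+ 1#

  ι-homo-* : ∀ m n → ι (m ℕ.* n) ≈ ι m * ι n
  ι-homo-* = ×1-homo-*

  ι-homo-^ : ∀ n k → ι (n ℕ.^ k) ≈ ι n ^ k
  ι-homo-^ n zero    = +-identityʳ 1#
  ι-homo-^ n (suc k) = trans (ι-homo-* n (n ℕ.^ k)) (*-congˡ (ι-homo-^ n k))

  ι-nonNeg : ∀ n → 0# ≤ ι n
  ι-nonNeg zero    = ≤-refl
  ι-nonNeg (suc n) = +-nonNeg 0≤1 (ι-nonNeg n)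

  ι-mono-≤ : ∀ {m n} → m ℕ.≤ n → ι m ≤ ι n
  ι-mono-≤ {n = n} ℕ.z≤n = ι-nonNeg n
  ι-mono-≤ (ℕ.s≤s m≤n)   = +-monoʳ-≤ 1# (ι-mono-≤ m≤n)

  1≤ι : ∀ n .{{_ : NonZero n}} → 1# ≤ ι n
  1≤ι (suc n) = x≤x+y (ι-nonNeg n)

  ^-nonNeg : ∀ {x} n → 0# ≤ x → 0# ≤ x ^ n
  ^-nonNeg zero    0≤x = 0≤1
  ^-nonNeg (suc n) 0≤x = *-nonNeg 0≤x (^-nonNeg n 0≤x)

  x≤1⇒x^n≤1 : ∀ {x} n → 0# ≤ x → x ≤ 1# → x ^ n ≤ 1#
  x≤1⇒x^n≤1 zero    0≤x x≤1 = ≤-refl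
  x≤1⇒x^n≤1 (suc n) 0≤x x≤1 =
    ≤-trans (*-mono-≤ 0≤1 (^-nonNeg n 0≤x) x≤1 (x≤1⇒x^n≤1 n 0≤x x≤1)) (≤-reflexive (*-identityˡ 1#))

-- Finite sums, Cauchy-Schwarz and Schur's test.

module Sums {ℓ} (R : CompleteOrderedField ℓ) where

  open CompleteOrderedField R
  open Reals R
  open OrderedFieldProperties R
  open SemiringSolver commutativeSemiring using (solve; _:=_; _:+_; _:*_)
  open import Relation.Binary.Reasoning.PartialOrder poset

  ∑-cong : ∀ ns {f g} → (∀ n → f n ≈ g n) → ∑ ns f ≈ ∑ ns g
  ∑-cong []       f≈g = refl
  ∑-cong (n ∷ ns) f≈g = +-cong (f≈g n) (∑-cong ns f≈g)

  ∑-mono-≤ : ∀ ns {f g} → (∀ {n} → n ∈ ns → f n ≤ g n) → ∑ ns f ≤ ∑ ns g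
  ∑-mono-≤ []       f≤g = ≤-refl
  ∑-mono-≤ (n ∷ ns) f≤g = +-mono-≤ (f≤g (here ≡.refl)) (∑-mono-≤ ns (λ n∈ → f≤g (there n∈)))

  ∑-nonNeg : ∀ ns {f : ℕ → Carrier} → (∀ n → 0# ≤ f n) → 0# ≤ ∑ ns f
  ∑-nonNeg []       0≤f = ≤-refl
  ∑-nonNeg (n ∷ ns) 0≤f = +-nonNeg (0≤f n) (∑-nonNeg ns 0≤f)

  ∑-+ : ∀ ns f g → ∑ ns (λ n → f n + g n) ≈ ∑ ns f + ∑ ns g
  ∑-+ []       f g = sym (+-identityʳ 0#)
  ∑-+ (n ∷ ns) f g = trans (+-congˡ (∑-+ ns f g))
    (solve 4 (λ a b c d → (a :+ b) :+ (c :+ d) := (a :+ c) :+ (b :+ d)) refl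
      (f n) (g n) (∑ ns f) (∑ ns g))

  ∑-*ˡ : ∀ ns c f → ∑ ns (λ n → c * f n) ≈ c * ∑ ns f
  ∑-*ˡ []       c f = sym (zeroʳ c)
  ∑-*ˡ (n ∷ ns) c f = trans (+-congˡ (∑-*ˡ ns c f)) (sym (distribˡ c (f n) (∑ ns f)))

  ∑-const : ∀ ns c → ∑ ns (λ _ → c) ≈ ι (length ns) * c
  ∑-const []       c = sym (zeroˡ c)
  ∑-const (n ∷ ns) c = trans (+-cong (sym (*-identityˡ c)) (∑-const ns c))
    (sym (distribʳ c 1# (ι (length ns))))

  ∑-swap : ∀ ms ns (f : ℕ → ℕ → Carrier) → ∑ ms (λ m → ∑ ns (f m)) ≈ ∑ ns (λ n → ∑ ms (λ m → f m n))
  ∑-swap []       ns f = sym (trans (∑-const ns 0#) (zeroʳ (ι (length ns))))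
  ∑-swap (m ∷ ms) ns f = trans (+-congˡ (∑-swap ms ns f))
    (sym (∑-+ ns (f m) (λ n → ∑ ms (λ m → f m n))))

  term≤∑ : ∀ {n ns} f → (∀ n → 0# ≤ f n) → n ∈ ns → f n ≤ ∑ ns f
  term≤∑ {ns = _ ∷ ns} f 0≤f (here ≡.refl) = x≤x+y (∑-nonNeg ns 0≤f)
  term≤∑ {ns = m ∷ _}  f 0≤f (there n∈)    = ≤-trans (term≤∑ f 0≤f n∈) (x≤y+x (0≤f m))

  𝟙 : ∀ {p} {P : Set p} → Dec P → Carrier
  𝟙 (yes _) = 1#
  𝟙 (no  _) = 0#

  𝟙-nonNeg : ∀ {p} {P : Set p} (P? : Dec P) → 0# ≤ 𝟙 P?
  𝟙-nonNeg (yes _) = 0≤1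
  𝟙-nonNeg (no  _) = ≤-refl

  𝟙-yes : ∀ {p} {P : Set p} (P? : Dec P) → P → 1# ≤ 𝟙 P?
  𝟙-yes (yes _) _ = ≤-refl
  𝟙-yes (no ¬p) p = ⊥-elim (¬p p)

  𝟙-×-≤ : ∀ {p q r} {P : Set p} {Q : Set q} {S : Set r} (P? : Dec P) (Q? : Dec Q) (S? : Dec S) →
          (P → Q → S) → 𝟙 P? * 𝟙 Q? ≤ 𝟙 S?
  𝟙-×-≤ (yes p) (yes q) S? f = ≤-trans (≤-reflexive (*-identityˡ 1#)) (𝟙-yes S? (f p q))
  𝟙-×-≤ (yes p) (no _)  S? f = ≤-trans (≤-reflexive (zeroʳ 1#)) (𝟙-nonNeg S?)
  𝟙-×-≤ (no _)  Q?      S? f = ≤-trans (≤-reflexive (zeroˡ (𝟙 Q?))) (𝟙-nonNeg S?)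

  -- Moving the condition into a weight leaves sums over fixed lists, whose order can be exchanged.
  ∑-filter : ∀ {p} {P : ℕ → Set p} (P? : ∀ n → Dec (P n)) ns f →
             ∑ (filter P? ns) f ≈ ∑ ns (λ n → 𝟙 (P? n) * f n)
  ∑-filter P? []       f = refl
  ∑-filter P? (n ∷ ns) f with P? n
  ... | yes _ = +-cong (sym (*-identityˡ (f n))) (∑-filter P? ns f)
  ... | no  _ = trans (∑-filter P? ns f) (trans (sym (+-identityˡ _)) (+-congʳ (sym (zeroˡ (f n)))))

  -- By induction on the list, without division: expanding the head against the tail leaves the
  -- cross term 2 y A ≤ y² W + B, which says that the weighted sum of the squares (y - f n)² over
  -- the tail is non-negative.
  cauchySchwarz : ∀ ns (w f : ℕ → Carrier) → (∀ n → 0# ≤ w n) →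
    ∑ ns (λ n → w n * f n) * ∑ ns (λ n → w n * f n) ≤ ∑ ns w * ∑ ns (λ n → w n * (f n * f n))
  cauchySchwarz []       w f 0≤w = ≤-reflexive refl
  cauchySchwarz (n ∷ ns) w f 0≤w = begin
    (v * y + A) * (v * y + A)
      ≈⟨ solve 3 (λ v y A → (v :* y :+ A) :* (v :* y :+ A)
           := v :* (v :* (y :* y)) :+ (v :* (y :* A :+ y :* A) :+ A :* A)) refl v y A ⟩
    v * (v * (y * y)) + (v * (y * A + y * A) + A * A)
      ≤⟨ +-monoʳ-≤ _ (+-mono-≤ (*-monoʳ-≤ (0≤w n) cross) (cauchySchwarz ns w f 0≤w)) ⟩
    v * (v * (y * y)) + (v * (y * y * W + B) + W * B)
      ≈⟨ solve 4 (λ v y W B → v :* (v :* (y :* y)) :+ (v :* (y :* y :* W :+ B) :+ W :* B)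
           := (v :+ W) :* (v :* (y :* y) :+ B)) refl v y W B ⟩
    (v + W) * (v * (y * y) + B)  ∎
    where
    v = w n
    y = f n
    A = ∑ ns (λ n → w n * f n)
    B = ∑ ns (λ n → w n * (f n * f n))
    W = ∑ ns w
    cross : y * A + y * A ≤ y * y * W + B
    cross = begin
      y * A + y * A  ≈⟨ +-cong (∑-*ˡ ns y _) (∑-*ˡ ns y _) ⟨
      ∑ ns (λ n → y * (w n * f n)) + ∑ ns (λ n → y * (w n * f n))
        ≈⟨ ∑-+ ns _ _ ⟨
      ∑ ns (λ n → y * (w n * f n) + y * (w n * f n))
        ≤⟨ ∑-mono-≤ ns (λ {n} _ → step n) ⟩
      ∑ ns (λ n → y * y * w n + w n * (f n * f n))
        ≈⟨ ∑-+ ns _ _ ⟩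
      ∑ ns (λ n → y * y * w n) + B
        ≈⟨ +-congʳ (∑-*ˡ ns (y * y) w) ⟩
      y * y * W + B  ∎
      where
      step : ∀ n → y * (w n * f n) + y * (w n * f n) ≤ y * y * w n + w n * (f n * f n)
      step n = begin
        y * (w n * f n) + y * (w n * f n)
          ≈⟨ solve 3 (λ y u z → y :* (u :* z) :+ y :* (u :* z)
               := u :* (y :* z :+ y :* z)) refl y (w n) (f n) ⟩
        w n * (y * f n + y * f n)
          ≤⟨ *-monoʳ-≤ (0≤w n) (2xy≤x²+y² y (f n)) ⟩
        w n * (y * y + f n * f n)
          ≈⟨ solve 3 (λ y u z → u :* (y :* y :+ z :* z)
               := y :* y :* u :+ u :* (z :* z)) refl y (w n) (f n) ⟩
        y * y * w n + w n * (f n * f n)  ∎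

  -- With ζ = χᵀη for η = χx one has ∑ η² = ∑ x ζ, and 2 Δ x ζ ≤ (Δ x)² + ζ² reduces the claim to
  -- ∑ ζ² ≤ Δ ∑ η², which is Cauchy–Schwarz with weights χ.
  schurTest : ∀ S T (χ : ℕ → ℕ → Carrier) → (∀ d n → 0# ≤ χ d n) → ∀ {Δ} → 0# < Δ →
    (∀ {d} → d ∈ T → ∑ S (λ n → χ d n * ∑ T (λ d′ → χ d′ n)) ≤ Δ) →
    ∀ (x : ℕ → Carrier) →
    ∑ T (λ d → ∑ S (λ n → χ d n * x n) * ∑ S (λ n → χ d n * x n)) ≤ Δ * ∑ S (λ n → x n * x n)
  schurTest S T χ 0≤χ {Δ} 0<Δ bound x =
    *-cancelˡ-≤ 0<Δ (+-cancelʳ-≤ (Δ * E) (begin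
      Δ * E + Δ * E
        ≈⟨ +-cong Δ*E≈ Δ*E≈ ⟩
      ∑ S (λ n → Δ * x n * ζ n) + ∑ S (λ n → Δ * x n * ζ n)
        ≈⟨ ∑-+ S _ _ ⟨
      ∑ S (λ n → Δ * x n * ζ n + Δ * x n * ζ n)
        ≤⟨ ∑-mono-≤ S (λ {n} _ → 2xy≤x²+y² (Δ * x n) (ζ n)) ⟩
      ∑ S (λ n → Δ * x n * (Δ * x n) + ζ n * ζ n)
        ≈⟨ ∑-+ S _ _ ⟩
      ∑ S (λ n → Δ * x n * (Δ * x n)) + ∑ S (λ n → ζ n * ζ n)
        ≤⟨ +-mono-≤ (≤-reflexive ΔΔQ≈) ∑ζ²≤ΔE ⟩
      Δ * (Δ * Q) + Δ * E  ∎))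
    where
    η ζ : ℕ → Carrier
    η d = ∑ S (λ n → χ d n * x n)
    ζ n = ∑ T (λ d → χ d n * η d)
    E = ∑ T (λ d → η d * η d)
    Q = ∑ S (λ n → x n * x n)

    ΔΔQ≈ : ∑ S (λ n → Δ * x n * (Δ * x n)) ≈ Δ * (Δ * Q)
    ΔΔQ≈ = begin-equality
      ∑ S (λ n → Δ * x n * (Δ * x n))
        ≈⟨ ∑-cong S (λ n →
             solve 2 (λ Δ y → Δ :* y :* (Δ :* y) := Δ :* Δ :* (y :* y)) refl Δ (x n)) ⟩
      ∑ S (λ n → Δ * Δ * (x n * x n))  ≈⟨ ∑-*ˡ S (Δ * Δ) _ ⟩
      Δ * Δ * Q                        ≈⟨ *-assoc Δ Δ Q ⟩
      Δ * (Δ * Q)                      ∎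

    E≈∑xζ : E ≈ ∑ S (λ n → x n * ζ n)
    E≈∑xζ = begin-equality
      E
        ≈⟨ ∑-cong T (λ d → ∑-*ˡ S (η d) _) ⟨
      ∑ T (λ d → ∑ S (λ n → η d * (χ d n * x n)))
        ≈⟨ ∑-swap T S _ ⟩
      ∑ S (λ n → ∑ T (λ d → η d * (χ d n * x n)))
        ≈⟨ ∑-cong S (λ n → ∑-cong T (λ d →
             solve 3 (λ e c y → e :* (c :* y) := y :* (c :* e)) refl (η d) (χ d n) (x n))) ⟩
      ∑ S (λ n → ∑ T (λ d → x n * (χ d n * η d)))
        ≈⟨ ∑-cong S (λ n → ∑-*ˡ T (x n) _) ⟩
      ∑ S (λ n → x n * ζ n)  ∎

    Δ*E≈ : Δ * E ≈ ∑ S (λ n → Δ * x n * ζ n)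
    Δ*E≈ = begin-equality
      Δ * E                            ≈⟨ *-congˡ E≈∑xζ ⟩
      Δ * ∑ S (λ n → x n * ζ n)        ≈⟨ ∑-*ˡ S Δ _ ⟨
      ∑ S (λ n → Δ * (x n * ζ n))      ≈⟨ ∑-cong S (λ n → *-assoc Δ (x n) (ζ n)) ⟨
      ∑ S (λ n → Δ * x n * ζ n)        ∎

    -- After Cauchy-Schwarz and an exchange of sums, η(d)² is multiplied by the sum of χ d n ω(n)
    -- over n, where ω(n) counts the weight of all d′ at n; this is the row sum that `bound`
    -- controls.
    ∑ζ²≤ΔE : ∑ S (λ n → ζ n * ζ n) ≤ Δ * E
    ∑ζ²≤ΔE = begin
      ∑ S (λ n → ζ n * ζ n)
        ≤⟨ ∑-mono-≤ S (λ {n} _ → cauchySchwarz T (λ d → χ d n) η (λ d → 0≤χ d n)) ⟩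
      ∑ S (λ n → ω n * ∑ T (λ d → χ d n * (η d * η d)))
        ≈⟨ ∑-cong S (λ n → ∑-*ˡ T (ω n) _) ⟨
      ∑ S (λ n → ∑ T (λ d → ω n * (χ d n * (η d * η d))))
        ≈⟨ ∑-swap S T _ ⟩
      ∑ T (λ d → ∑ S (λ n → ω n * (χ d n * (η d * η d))))
        ≈⟨ ∑-cong T (λ d → ∑-cong S (λ n →
             solve 3 (λ o c e → o :* (c :* (e :* e)) := e :* e :* (c :* o)) refl (ω n) (χ d n) (η d))) ⟩
      ∑ T (λ d → ∑ S (λ n → η d * η d * (χ d n * ω n)))
        ≈⟨ ∑-cong T (λ d → ∑-*ˡ S (η d * η d) _) ⟩
      ∑ T (λ d → η d * η d * ∑ S (λ n → χ d n * ω n))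
        ≤⟨ ∑-mono-≤ T (λ {d} d∈T → *-monoʳ-≤ (0≤x*x (η d)) (bound d∈T)) ⟩
      ∑ T (λ d → η d * η d * Δ)
        ≈⟨ ∑-cong T (λ d → *-comm (η d * η d) Δ) ⟩
      ∑ T (λ d → Δ * (η d * η d))
        ≈⟨ ∑-*ˡ T Δ _ ⟩
      Δ * E  ∎
      where
      ω : ℕ → Carrier
      ω n = ∑ T (λ d → χ d n)

-- Counting multiples in dyadic intervals.

module DyadicDivisibility {ℓ} (R : CompleteOrderedField ℓ) where

  open CompleteOrderedField R
  open Reals R
  open OrderedFieldProperties R
  open Sums R
  open SemiringSolver commutativeSemiring using (solve; con; _:=_; _:+_; _:*_)
  open import Relation.Binary.Reasoning.PartialOrder poset

  χ : ℕ → ℕ → Carrier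
  χ d n = 𝟙 (d ∣? n)

  0≤χ : ∀ d n → 0# ≤ χ d n
  0≤χ d n = 𝟙-nonNeg (d ∣? n)

  ∼⇒≤ : ∀ {n X} → n ∈ dyadic X → X ≤ ι n
  ∼⇒≤ {n} {X} n∈ = proj₁ (Equivalence.to (∈-dyadic n X) n∈)

  ∼⇒≤2* : ∀ {n X} → n ∈ dyadic X → ι n ≤ ι 2 * X
  ∼⇒≤2* {n} {X} n∈ = proj₂ (Equivalence.to (∈-dyadic n X) n∈)

  dyadic-increasing : ∀ X → AllPairs ℕ._<_ (dyadic X)
  dyadic-increasing X = AllPairs.filter⁺ (_∼? X) (AllPairs.applyUpTo⁺₁ _ _ (λ i<j _ → i<j))

  nextMultiple : ∀ {m n n′} → m ∣ n → m ∣ n′ → n ℕ.< n′ → n ℕ.+ m ℕ.≤ n′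
  nextMultiple {m} {n} {n′} m∣n m∣n′ n<n′ = ≡.subst (n ℕ.+ m ℕ.≤_) (m+[n∸m]≡n (<⇒≤ n<n′))
    (+-monoʳ-≤ℕ n (∣⇒≤ {{ℕ.>-nonZero (m<n⇒0<n∸m n<n′)}} m∣n′∸n))
    where
    open import Data.Nat.Properties
      using (m+[n∸m]≡n; <⇒≤; m<n⇒0<n∸m) renaming (+-monoʳ-≤ to +-monoʳ-≤ℕ)
    m∣n′∸n : m ∣ n′ ℕ.∸ n
    m∣n′∸n = ∣m+n∣m⇒∣n (≡.subst (m ∣_) (≡.sym (m+[n∸m]≡n (<⇒≤ n<n′))) m∣n′) m∣n

  -- Consecutive multiples are at least m apart, so c serves as a moving lower bound that jumps from
  -- the head n to n + m. The hypothesis c ≤ B + m is what the empty list needs, and it persists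
  -- because n ≤ B.
  length-multiples-≤ : ∀ m {B} c ns → AllPairs ℕ._<_ ns → All (m ∣_) ns → All (λ n → c ≤ ι n) ns →
    All (λ n → ι n ≤ B) ns → c ≤ B + ι m → ι m * ι (length ns) + c ≤ B + ι m
  length-multiples-≤ m c [] _ _ _ _ c≤ = begin
    ι m * 0# + c  ≈⟨ +-congʳ (zeroʳ (ι m)) ⟩
    0# + c        ≈⟨ +-identityˡ c ⟩
    c             ≤⟨ c≤ ⟩
    _             ∎
  length-multiples-≤ m {B} c (n ∷ ns) (n< ∷ inc) (m∣n ∷ m∣) (c≤n ∷ _) (n≤B ∷ ≤B) _ = begin
    ι m * (1# + k) + c     ≤⟨ +-monoʳ-≤ _ c≤n ⟩
    ι m * (1# + k) + ι n   ≈⟨ solve 3 (λ m k n → m :* (con 1 :+ k) :+ n := m :* k :+ (n :+ m))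
                                refl (ι m) k (ι n) ⟩
    ι m * k + (ι n + ι m)  ≈⟨ +-congˡ (ι-homo-+ n m) ⟨
    ι m * k + ι (n ℕ.+ m)
      ≤⟨ length-multiples-≤ m (ι (n ℕ.+ m)) ns inc m∣
           (All.zipWith (λ (m∣n′ , n<n′) → ι-mono-≤ (nextMultiple m∣n m∣n′ n<n′)) (m∣ , n<)) ≤B
           (≤-trans (≤-reflexive (ι-homo-+ n m)) (+-mono-≤ n≤B ≤-refl)) ⟩
    B + ι m                ∎
    where k = ι (length ns)

  -- The bound X/m + 1 for the number of multiples, kept multiplied by m: this is the weight under
  -- which it enters the gcd sum, and it covers m = 0.
  multiplesCount : ∀ {X} m → 0# ≤ X → ι m * ∑ (dyadic X) (χ m) ≤ X + ι m
  multiplesCount {X} m 0≤X = +-cancelʳ-≤ X (begin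
    ι m * ∑ (dyadic X) (χ m) + X  ≈⟨ +-congʳ (*-congˡ count≈) ⟩
    ι m * ι (length ns) + X
      ≤⟨ length-multiples-≤ m {ι 2 * X} X ns (AllPairs.filter⁺ (m ∣?_) (dyadic-increasing X))
           (All.all-filter (m ∣?_) (dyadic X))
           (All.filter⁺ (m ∣?_) (All.tabulate ∼⇒≤)) (All.filter⁺ (m ∣?_) (All.tabulate ∼⇒≤2*))
           X≤2X+m ⟩
    ι 2 * X + ι m                 ≈⟨ 2X+m≈ ⟩
    X + ι m + X                   ∎)
    where
    ns = filter (m ∣?_) (dyadic X)
    2X+m≈ : ι 2 * X + ι m ≈ X + ι m + X
    2X+m≈ = solve 2 (λ X m → (con 1 :+ (con 1 :+ con 0)) :* X :+ m := X :+ m :+ X) refl X (ι m)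
    X≤2X+m : X ≤ ι 2 * X + ι m
    X≤2X+m = ≤-trans (x≤y+x (+-nonNeg 0≤X (ι-nonNeg m))) (≤-reflexive (sym 2X+m≈))
    count≈ : ∑ (dyadic X) (χ m) ≈ ι (length ns)
    count≈ = begin-equality
      ∑ (dyadic X) (χ m)                   ≈⟨ ∑-cong (dyadic X) (λ n → *-identityʳ (χ m n)) ⟨
      ∑ (dyadic X) (λ n → χ m n * 1#)      ≈⟨ ∑-filter (m ∣?_) (dyadic X) (λ _ → 1#) ⟨
      ∑ ns (λ _ → 1#)                      ≈⟨ ∑-const ns 1# ⟩
      ι (length ns) * 1#                   ≈⟨ *-identityʳ _ ⟩
      ι (length ns)                        ∎

  dyadic-nonZero : ∀ {d D} → 1# ≤ D → d ∈ dyadic D → NonZero d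
  dyadic-nonZero {zero}  1≤D d∈ = ⊥-elim (0≉1 (antisym 0≤1 (≤-trans 1≤D (∼⇒≤ d∈))))
  dyadic-nonZero {suc _} _   _  = _

  -- Every integer is a multiple of 1, and the rounding error 1 is absorbed by D ≥ 1.
  ∑1≤2D : ∀ {D} → 1# ≤ D → ∑ (dyadic D) (λ _ → 1#) ≤ ι 2 * D
  ∑1≤2D {D} 1≤D = begin
    ∑ (dyadic D) (λ _ → 1#)  ≤⟨ ∑-mono-≤ (dyadic D) (λ {n} _ → 𝟙-yes (1 ∣? n) (1∣ n)) ⟩
    ∑ (dyadic D) (χ 1)       ≈⟨ solve 1 (λ s → s := (con 1 :+ con 0) :* s) refl _ ⟩
    ι 1 * ∑ (dyadic D) (χ 1) ≤⟨ multiplesCount 1 (≤-trans 0≤1 1≤D) ⟩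
    D + ι 1                  ≤⟨ +-monoʳ-≤ D (+-mono-≤ 1≤D ≤-refl) ⟩
    D + (D + 0#)             ≈⟨ solve 1 (λ D → D :+ (D :+ con 0)
                                  := (con 1 :+ (con 1 :+ con 0)) :* D) refl D ⟩
    ι 2 * D                  ∎

  -- The gcd is one of the terms g with g dividing both d and d′. After the exchange of sums each
  -- divisor g of d contributes at most D + g, and g ≤ d ≤ 2D makes this 3D.
  ∑gcd≤ : ∀ {d D} L → 1# ≤ D → d ∈ dyadic D → DivisorBounds.DivisorsIn d L →
          ∑ (dyadic D) (λ d′ → ι (gcd d d′)) ≤ ι (length L) * (ι 3 * D)
  ∑gcd≤ {d} {D} L 1≤D d∈ L∋ = begin
    ∑ T (λ d′ → ι (gcd d d′))
      ≤⟨ ∑-mono-≤ T (λ {d′} _ → gcd≤ d′) ⟩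
    ∑ T (λ d′ → ∑ G (λ g → ι g * χ g d′))
      ≈⟨ ∑-swap T G _ ⟩
    ∑ G (λ g → ∑ T (λ d′ → ι g * χ g d′))
      ≈⟨ ∑-cong G (λ g → ∑-*ˡ T (ι g) (χ g)) ⟩
    ∑ G (λ g → ι g * ∑ T (χ g))
      ≤⟨ ∑-mono-≤ G (λ {g} g∈ → ≤-trans (multiplesCount g 0≤D) (+-monoʳ-≤ D (g≤2D g∈))) ⟩
    ∑ G (λ _ → D + ι 2 * D)
      ≈⟨ ∑-const G _ ⟩
    ι (length G) * (D + ι 2 * D)
      ≤⟨ *-monoˡ-≤ (+-nonNeg 0≤D (*-nonNeg (ι-nonNeg 2) 0≤D)) (ι-mono-≤ (length-filter (_∣? d) L)) ⟩
    ι (length L) * (D + ι 2 * D)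
      ≈⟨ *-congˡ (solve 1 (λ D → D :+ (con 1 :+ (con 1 :+ con 0)) :* D
                          := (con 1 :+ (con 1 :+ (con 1 :+ con 0))) :* D) refl D) ⟩
    ι (length L) * (ι 3 * D)  ∎
    where
    T = dyadic D
    -- The filter discards members of `L` that do not divide d, for which g ≤ 2D could fail.
    G = filter (_∣? d) L
    0≤D = ≤-trans 0≤1 1≤D
    gcd≤ : ∀ d′ → ι (gcd d d′) ≤ ∑ G (λ g → ι g * χ g d′)
    gcd≤ d′ = begin
      ι (gcd d d′)                     ≈⟨ *-identityʳ _ ⟨
      ι (gcd d d′) * 1#                ≤⟨ *-monoʳ-≤ (ι-nonNeg (gcd d d′))
                                            (𝟙-yes (gcd d d′ ∣? d′) (gcd[m,n]∣n d d′)) ⟩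
      ι (gcd d d′) * χ (gcd d d′) d′
        ≤⟨ term≤∑ (λ g → ι g * χ g d′) (λ g → *-nonNeg (ι-nonNeg g) (0≤χ g d′))
             (∈-filter⁺ (_∣? d) (L∋ (gcd[m,n]∣m d d′)) (gcd[m,n]∣m d d′)) ⟩
      ∑ G (λ g → ι g * χ g d′)         ∎
    g≤2D : ∀ {g} → g ∈ G → ι g ≤ ι 2 * D
    g≤2D g∈ = ≤-trans
      (ι-mono-≤ (∣⇒≤ {{dyadic-nonZero 1≤D d∈}} (proj₂ (∈-filter⁻ (_∣? d) {xs = L} g∈))))
      (∼⇒≤2* d∈)

  -- With w the inverse of d d′ = gcd · lcm, multiplying lcm · N ≤ X + lcm by gcd · w isolates N.
  -- Then w ≤ u², since d and d′ are at least D.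
  lcmCount : ∀ {d d′ X D u} → 0# ≤ X → 1# ≤ D → 0# ≤ u → D * u ≈ 1# →
             d ∈ dyadic D → d′ ∈ dyadic D →
             ∑ (dyadic X) (χ (lcm d d′)) ≤ 1# + X * (u * u) * ι (gcd d d′)
  lcmCount {d} {d′} {X} {D} {u} 0≤X 1≤D 0≤u Du≈1 d∈ d′∈
    with nonNegInverse (1≤x⇒0<x (≤-trans 1≤D (∼⇒≤ d∈)))
       | nonNegInverse (1≤x⇒0<x (≤-trans 1≤D (∼⇒≤ d′∈)))
  ... | v , 0≤v , dv≈1 | v′ , 0≤v′ , d′v′≈1 = begin
    N                              ≈⟨ *-identityˡ N ⟨
    1# * N                         ≈⟨ *-congʳ lgw≈1 ⟨
    l * g * w * N                  ≈⟨ solve 4 (λ l g w N → l :* g :* w :* N := w :* (g :* (l :* N)))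
                                        refl l g w N ⟩
    w * (g * (l * N))              ≤⟨ *-monoʳ-≤ 0≤w (*-monoʳ-≤ (ι-nonNeg (gcd d d′))
                                        (multiplesCount (lcm d d′) 0≤X)) ⟩
    w * (g * (X + l))              ≈⟨ solve 4 (λ l g w X → w :* (g :* (X :+ l)) := l :* g :* w :+ X :* w :* g)
                                        refl l g w X ⟩
    l * g * w + X * w * g          ≈⟨ +-congʳ lgw≈1 ⟩
    1# + X * w * g                 ≤⟨ +-monoʳ-≤ 1# (*-monoˡ-≤ (ι-nonNeg (gcd d d′))
                                        (*-monoʳ-≤ 0≤X w≤uu)) ⟩
    1# + X * (u * u) * g           ∎
    where
    N = ∑ (dyadic X) (χ (lcm d d′))
    l = ι (lcm d d′)
    g = ι (gcd d d′)
    w = v * v′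
    0≤w : 0# ≤ w
    0≤w = *-nonNeg 0≤v 0≤v′
    w≤uu : w ≤ u * u
    w≤uu = *-mono-≤ 0≤u 0≤v′ (inverse-antitone 0≤u 0≤v Du≈1 dv≈1 (∼⇒≤ d∈))
                             (inverse-antitone 0≤u 0≤v′ Du≈1 d′v′≈1 (∼⇒≤ d′∈))
    lgw≈1 : l * g * w ≈ 1#
    lgw≈1 = begin-equality
      l * g * w                        ≈⟨ *-congʳ (*-comm l g) ⟩
      g * l * w                        ≈⟨ *-congʳ (ι-homo-* (gcd d d′) (lcm d d′)) ⟨
      ι (gcd d d′ ℕ.* lcm d d′) * w    ≡⟨ ≡.cong (λ n → ι n * w) (gcd*lcm d d′) ⟩
      ι (d ℕ.* d′) * w                 ≈⟨ *-congʳ (ι-homo-* d d′) ⟩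
      ι d * ι d′ * (v * v′)
        ≈⟨ solve 4 (λ d d′ v v′ → d :* d′ :* (v :* v′) := d :* v :* (d′ :* v′))
             refl (ι d) (ι d′) v v′ ⟩
      ι d * v * (ι d′ * v′)            ≈⟨ *-cong dv≈1 d′v′≈1 ⟩
      1# * 1#                          ≈⟨ *-identityˡ 1# ⟩
      1#                               ∎

  -- One of the two factors u = 1/D cancels against the D of the gcd sum; the other stays with τ(d).
  rowSum≤ : ∀ {d X D u} L → 0# ≤ X → 1# ≤ D → 0# ≤ u → D * u ≈ 1# →
    d ∈ dyadic D → DivisorBounds.DivisorsIn d L →
    ∑ (dyadic X) (λ n → χ d n * ∑ (dyadic D) (λ d′ → χ d′ n)) ≤ ι 2 * D + ι 3 * (X * (ι (length L) * u))
  rowSum≤ {d} {X} {D} {u} L 0≤X 1≤D 0≤u Du≈1 d∈ L∋ = begin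
    ∑ S (λ n → χ d n * ∑ T (λ d′ → χ d′ n))
      ≈⟨ ∑-cong S (λ n → ∑-*ˡ T (χ d n) _) ⟨
    ∑ S (λ n → ∑ T (λ d′ → χ d n * χ d′ n))
      ≈⟨ ∑-swap S T _ ⟩
    ∑ T (λ d′ → ∑ S (λ n → χ d n * χ d′ n))
      ≤⟨ ∑-mono-≤ T (λ {d′} _ → ∑-mono-≤ S (λ {n} _ →
           𝟙-×-≤ (d ∣? n) (d′ ∣? n) (lcm d d′ ∣? n) lcm-least)) ⟩
    ∑ T (λ d′ → ∑ S (χ (lcm d d′)))
      ≤⟨ ∑-mono-≤ T (λ d′∈ → lcmCount 0≤X 1≤D 0≤u Du≈1 d∈ d′∈) ⟩
    ∑ T (λ d′ → 1# + X * (u * u) * ι (gcd d d′))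
      ≈⟨ trans (∑-+ T _ _) (+-congˡ (∑-*ˡ T (X * (u * u)) _)) ⟩
    ∑ T (λ _ → 1#) + X * (u * u) * ∑ T (λ d′ → ι (gcd d d′))
      ≤⟨ +-mono-≤ (∑1≤2D 1≤D)
           (*-monoʳ-≤ (*-nonNeg 0≤X (*-nonNeg 0≤u 0≤u)) (∑gcd≤ L 1≤D d∈ L∋)) ⟩
    ι 2 * D + X * (u * u) * (t * (ι 3 * D))
      ≈⟨ +-congˡ (solve 5 (λ X u t c D → X :* (u :* u) :* (t :* (c :* D))
                                     := c :* (X :* (t :* u)) :* (D :* u))
                   refl X u t (ι 3) D) ⟩
    ι 2 * D + ι 3 * (X * (t * u)) * (D * u)
      ≈⟨ +-congˡ (trans (*-congˡ Du≈1) (*-identityʳ _)) ⟩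
    ι 2 * D + ι 3 * (X * (t * u))  ∎
    where
    S = dyadic X
    T = dyadic D
    t = ι (length L)

-- The real power of D and the final inequality.

module LargeSieve {ℓ} (R : CompleteOrderedField ℓ) where

  open CompleteOrderedField R
  open Reals R
  open OrderedFieldProperties R
  open Sums R
  open DyadicDivisibility R
  open DivisorBounds using (DivisorBound; divisorBound)
  open RingProperties ring using (x[y-z]≈xy-xz)
  open Exp commutativeSemiring using (^-congˡ; ^-distrib-*)
  open SemiringSolver commutativeSemiring using (solve; con; _:=_; _:+_; _:*_)
  open import Relation.Binary.Reasoning.PartialOrder poset

  ∃[1/q≤ε] : ∀ {ε} → 0# < ε → ∃[ k ] 1# ≤ ι (suc k) * ε
  ∃[1/q≤ε] {ε} 0<ε with nonNegInverse 0<ε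
  ... | v , _ , εv≈1 with archimedean v
  ...   | k , v≤k = k , (begin
    1#              ≈⟨ εv≈1 ⟨
    ε * v           ≤⟨ *-monoʳ-≤ (proj₁ 0<ε) (≤-trans v≤k (x≤y+x 0≤1)) ⟩
    ε * ι (suc k)   ≈⟨ *-comm ε _ ⟩
    ι (suc k) * ε   ∎)

  -- y = t / (c D) satisfies y^q D^q ≤ D, so that 1/q - 1 ≤ ε - 1 gives y ≤ D^(ε-1).
  root≤power : ∀ {ε D u} k c t .{{_ : NonZero c}} → 1# ≤ ι (suc k) * ε →
    (1≤D : 1# ≤ D) → 0# ≤ u → D * u ≈ 1# →
    ι t ^ suc k ≤ ι c * D → ι t * u ≤ ι c * (D ^ᴿ[ 1≤D ] (ε - 1#))
  root≤power {ε} {D} {u} k c t 1≤qε 1≤D 0≤u Du≈1 t^q≤cD with nonNegInverse (1≤x⇒0<x (1≤ι c))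
  ... | w , 0≤w , cw≈1 = begin
    ι t * u                ≈⟨ *-identityˡ _ ⟨
    1# * (ι t * u)         ≈⟨ *-congʳ cw≈1 ⟨
    ι c * w * (ι t * u)    ≈⟨ solve 4 (λ c w t u → c :* w :* (t :* u) := c :* (t :* w :* u))
                                refl (ι c) w (ι t) u ⟩
    ι c * y                ≤⟨ *-monoʳ-≤ (ι-nonNeg c) (proj₁ (^ᴿ-isSupremum D 1≤D (ε - 1#)) y y∈) ⟩
    ι c * (D ^ᴿ[ 1≤D ] (ε - 1#))  ∎
    where
    q = suc k
    y = ι t * w * u
    w≤1 : w ≤ 1#
    w≤1 = inverse-antitone 0≤1 0≤w (*-identityˡ 1#) cw≈1 (1≤ι c)
    1≤ : ι 1 ≤ ι q + ι q * (ε - 1#)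
    1≤ = begin
      ι 1                            ≈⟨ +-identityʳ 1# ⟩
      1#                             ≤⟨ 1≤qε ⟩
      ι q * ε                        ≈⟨ x+[y-x]≈y (ι q * 1#) (ι q * ε) ⟨
      ι q * 1# + (ι q * ε - ι q * 1#)  ≈⟨ +-cong (*-identityʳ (ι q)) (sym (x[y-z]≈xy-xz (ι q) ε 1#)) ⟩
      ι q + ι q * (ε - 1#)           ∎
    y^qD^q≤D : y ^ q * D ^ q ≤ D ^ 1
    y^qD^q≤D = begin
      y ^ q * D ^ q          ≈⟨ ^-distrib-* y D q ⟨
      (y * D) ^ q            ≈⟨ ^-congˡ q yD≈ ⟩
      (ι t * w) ^ q          ≈⟨ ^-distrib-* (ι t) w q ⟩
      ι t ^ q * w ^ q        ≤⟨ *-mono-≤ (*-nonNeg (ι-nonNeg c) 0≤D) (^-nonNeg q 0≤w)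
                                  t^q≤cD w^q≤w ⟩
      ι c * D * w            ≈⟨ solve 3 (λ c D w → c :* D :* w := c :* w :* (D :* con 1))
                                  refl (ι c) D w ⟩
      ι c * w * (D * 1#)     ≈⟨ *-congʳ cw≈1 ⟩
      1# * (D * 1#)          ≈⟨ *-identityˡ _ ⟩
      D ^ 1                  ∎
      where
      0≤D = ≤-trans 0≤1 1≤D
      -- Since w = 1/c ≤ 1, dividing by c instead of by its q-th root is enough to absorb the
      -- constant c.
      w^q≤w : w ^ q ≤ w
      w^q≤w = ≤-trans (*-monoʳ-≤ 0≤w (x≤1⇒x^n≤1 k 0≤w w≤1)) (≤-reflexive (*-identityʳ w))
      yD≈ : y * D ≈ ι t * w
      yD≈ = begin-equality
        ι t * w * u * D    ≈⟨ solve 4 (λ t w u D → t :* w :* u :* D := t :* w :* (D :* u))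
                                refl (ι t) w u D ⟩
        ι t * w * (D * u)  ≈⟨ *-congˡ Du≈1 ⟩
        ι t * w * 1#       ≈⟨ *-identityʳ _ ⟩
        ι t * w            ∎
    y∈ : BelowRationalPower D (ε - 1#) y
    -- The exponent 1/q - 1 = (1 - q)/q has n = 1, m = q and denominator `suc k`.
    y∈ = q , 1 , k , *-nonNeg (*-nonNeg (ι-nonNeg t) 0≤w) 0≤u , 1≤ , y^qD^q≤D

  re-∑ℂ : ∀ ns f → re (∑ℂ ns f) ≈ ∑ ns (λ n → re (f n))
  re-∑ℂ []       f = refl
  re-∑ℂ (n ∷ ns) f = +-congˡ (re-∑ℂ ns f)

  im-∑ℂ : ∀ ns f → im (∑ℂ ns f) ≈ ∑ ns (λ n → im (f n))
  im-∑ℂ []       f = refl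
  im-∑ℂ (n ∷ ns) f = +-congˡ (im-∑ℂ ns f)

  x^2≈x*x : ∀ x → x ^ 2 ≈ x * x
  x^2≈x*x x = *-congˡ (*-identityʳ x)

  ∑-∣∣² : ∀ ns (z : ℕ → ℂ) →
    ∑ ns (λ n → ∣ z n ∣²) ≈
    ∑ ns (λ n → re (z n) * re (z n)) + ∑ ns (λ n → im (z n) * im (z n))
  ∑-∣∣² ns z = trans
    (∑-cong ns (λ n → +-cong (x^2≈x*x (re (z n))) (x^2≈x*x (im (z n))))) (∑-+ ns _ _)

  -- The kernel χ is real, so real and imaginary parts decouple.
  schurTestℂ : ∀ {X D Δ} → 0# < Δ →
    (∀ {d} → d ∈ dyadic D → ∑ (dyadic X) (λ n → χ d n * ∑ (dyadic D) (λ d′ → χ d′ n)) ≤ Δ) →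
    ∀ ξ → ∑ (dyadic D) (λ d → ∣ ∑ℂ (filter (d ∣?_) (dyadic X)) ξ ∣²) ≤
          Δ * ∑ (dyadic X) (λ n → ∣ ξ n ∣²)
  schurTestℂ {X} {D} {Δ} 0<Δ bound ξ = begin
    ∑ T (λ d → ∣ ∑ℂ (filter (d ∣?_) S) ξ ∣²)
      ≈⟨ ∑-∣∣² T _ ⟩
    ∑ T (λ d → re (z d) * re (z d)) + ∑ T (λ d → im (z d) * im (z d))
      ≈⟨ +-cong (∑-cong T (λ d → *-cong (re-z d) (re-z d)))
                 (∑-cong T (λ d → *-cong (im-z d) (im-z d))) ⟩
    ∑ T (λ d → ∑ S (λ n → χ d n * re (ξ n)) * ∑ S (λ n → χ d n * re (ξ n))) +
    ∑ T (λ d → ∑ S (λ n → χ d n * im (ξ n)) * ∑ S (λ n → χ d n * im (ξ n)))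
      ≤⟨ +-mono-≤ (schurTest S T χ 0≤χ 0<Δ bound (λ n → re (ξ n)))
                  (schurTest S T χ 0≤χ 0<Δ bound (λ n → im (ξ n))) ⟩
    Δ * ∑ S (λ n → re (ξ n) * re (ξ n)) + Δ * ∑ S (λ n → im (ξ n) * im (ξ n))
      ≈⟨ distribˡ Δ _ _ ⟨
    Δ * (∑ S (λ n → re (ξ n) * re (ξ n)) + ∑ S (λ n → im (ξ n) * im (ξ n)))
      ≈⟨ *-congˡ (∑-∣∣² S ξ) ⟨
    Δ * ∑ S (λ n → ∣ ξ n ∣²)  ∎
    where
    S = dyadic X
    T = dyadic D
    z : ℕ → ℂ
    z d = ∑ℂ (filter (d ∣?_) S) ξ
    re-z : ∀ d → re (z d) ≈ ∑ S (λ n → χ d n * re (ξ n))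
    re-z d = trans (re-∑ℂ (filter (d ∣?_) S) ξ) (∑-filter (d ∣?_) S _)
    im-z : ∀ d → im (z d) ≈ ∑ S (λ n → χ d n * im (ξ n))
    im-z d = trans (im-∑ℂ (filter (d ∣?_) S) ξ) (∑-filter (d ∣?_) S _)

  -- The factor 2 comes from d ≤ 2D; the successor makes the constant invertible, as `root≤power`
  -- requires.
  τ^q≤cD : ∀ {C d D} q t → 0# ≤ D → d ∈ dyadic D → t ℕ.^ q ℕ.≤ C ℕ.* d →
           ι t ^ q ≤ ι (suc (C ℕ.* 2)) * D
  τ^q≤cD {C} {d} {D} q t 0≤D d∈ t^q≤Cd = begin
    ι t ^ q               ≈⟨ ι-homo-^ t q ⟨
    ι (t ℕ.^ q)           ≤⟨ ι-mono-≤ t^q≤Cd ⟩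
    ι (C ℕ.* d)           ≈⟨ ι-homo-* C d ⟩
    ι C * ι d             ≤⟨ *-monoʳ-≤ (ι-nonNeg C) (∼⇒≤2* d∈) ⟩
    ι C * (ι 2 * D)       ≈⟨ *-assoc (ι C) (ι 2) D ⟨
    ι C * ι 2 * D         ≈⟨ *-congʳ (ι-homo-* C 2) ⟨
    ι (C ℕ.* 2) * D       ≤⟨ *-monoˡ-≤ 0≤D (x≤y+x 0≤1) ⟩
    ι (suc (C ℕ.* 2)) * D ∎

  largeSieve : ∀ ε → 0# < ε →
    ∃[ K ] 0# < K ×
      (∀ X D → 1# ≤ X → (1≤D : 1# ≤ D) → ∀ ξ →
        ∑ (dyadic D) (λ d → ∣ ∑ℂ (filter (d ∣?_) (dyadic X)) ξ ∣²)
          ≤ K * (X * (D ^ᴿ[ 1≤D ] (ε - 1#)) + D) * ∑ (dyadic X) (λ n → ∣ ξ n ∣²))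
  largeSieve ε 0<ε with ∃[1/q≤ε] 0<ε
  ... | k , 1≤qε with divisorBound (suc k)
  ...   | C , bounds = K , 1≤x⇒0<x 1≤K , main
    where
    c = suc (C ℕ.* 2)
    -- The 2 bounds the rounding errors (at most 2D values d′), the 3c comes from the gcd sum with
    -- the divisor bound. Their sum serves as a common coefficient for both X s and D.
    K = ι 2 + ι 3 * ι c
    0≤3c : 0# ≤ ι 3 * ι c
    0≤3c = *-nonNeg (ι-nonNeg 3) (ι-nonNeg c)
    1≤K : 1# ≤ K
    1≤K = ≤-trans (1≤ι 2) (x≤x+y 0≤3c)
    main : ∀ X D → 1# ≤ X → (1≤D : 1# ≤ D) → ∀ ξ → _
    main X D 1≤X 1≤D with nonNegInverse (1≤x⇒0<x 1≤D)
    ... | u , 0≤u , Du≈1 = schurTestℂ 0<Δ rowBound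
      where
      s = D ^ᴿ[ 1≤D ] (ε - 1#)
      0≤X = ≤-trans 0≤1 1≤X
      0≤D = ≤-trans 0≤1 1≤D
      0<ι[c] = 1≤x⇒0<x (1≤ι c)
      power : ∀ t → ι t ^ suc k ≤ ι c * D → ι t * u ≤ ι c * s
      power t = root≤power k c t 1≤qε 1≤D 0≤u Du≈1
      -- The case t = 0 exhibits 0 as a member of the set whose supremum is s.
      0≤s : 0# ≤ s
      0≤s = *-cancelˡ-≤ 0<ι[c] (begin
        ι c * 0#  ≈⟨ zeroʳ (ι c) ⟩
        0#        ≈⟨ zeroˡ u ⟨
        ι 0 * u   ≤⟨ power 0 (≤-trans (≤-reflexive (zeroˡ _)) (*-nonNeg (ι-nonNeg c) 0≤D)) ⟩
        ι c * s   ∎)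
      0≤Xs = *-nonNeg 0≤X 0≤s
      0<Δ : 0# < K * (X * s + D)
      0<Δ = *-pos (1≤x⇒0<x 1≤K) (1≤x⇒0<x (≤-trans 1≤D (x≤y+x 0≤Xs)))
      rowBound : ∀ {d} → d ∈ dyadic D →
        ∑ (dyadic X) (λ n → χ d n * ∑ (dyadic D) (λ d′ → χ d′ n)) ≤ K * (X * s + D)
      rowBound {d} d∈ with bounds d {{dyadic-nonZero 1≤D d∈}}
      ... | L , L∋ , |L|^q≤Cd = begin
        ∑ (dyadic X) (λ n → χ d n * ∑ (dyadic D) (λ d′ → χ d′ n))
          ≤⟨ rowSum≤ L 0≤X 1≤D 0≤u Du≈1 d∈ L∋ ⟩
        ι 2 * D + ι 3 * (X * (ι (length L) * u))
          ≤⟨ +-monoʳ-≤ _ (*-monoʳ-≤ (ι-nonNeg 3) (*-monoʳ-≤ 0≤X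
               (power (length L) (τ^q≤cD {C} (suc k) (length L) 0≤D d∈ |L|^q≤Cd)))) ⟩
        ι 2 * D + ι 3 * (X * (ι c * s))
          ≤⟨ +-mono-≤ (x≤y+x (*-nonNeg (ι-nonNeg 2) 0≤Xs)) (x≤x+y (*-nonNeg 0≤3c 0≤D)) ⟩
        (ι 2 * (X * s) + ι 2 * D) + (ι 3 * (X * (ι c * s)) + ι 3 * ι c * D)
          ≈⟨ solve 6 (λ a b c X s D → (a :* (X :* s) :+ a :* D) :+ (b :* (X :* (c :* s)) :+ b :* c :* D)
                := (a :+ b :* c) :* (X :* s :+ D)) refl (ι 2) (ι 3) (ι c) X s D ⟩
        K * (X * s + D)  ∎

lemma3p1 : ∀ {ℓ : Level} (R : CompleteOrderedField ℓ) →
  let open CompleteOrderedField R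
      open Reals R in
  (ε : Carrier) → 0# < ε →
  ∃[ K ] 0# < K ×
    (∀ (X D : Carrier) → 1# ≤ X → (1≤D : 1# ≤ D) → (ξ : ℕ → ℂ) →
      ∑ (dyadic D) (λ d → ∣ ∑ℂ (filter (d ∣?_) (dyadic X)) ξ ∣²)
        ≤ K * (X * (D ^ᴿ[ 1≤D ] (ε - 1#)) + D) * ∑ (dyadic X) (λ n → ∣ ξ n ∣²))
lemma3p1 R = LargeSieve.largeSieve R
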